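{- There is no constant upper bound for the minimum absolute value of the entries of $\phi$; that is, for every natural number $N$ there exists a graph $G$ whose Seidel matrix is singular and such that every entry of $\phi(G)$ has absolute value greater than $N$.
   Context: All graphs are simple, undirected, finite, with at least one vertex. For a graph $G$ with vertices $v_1,\dots,v_n$ and adjacency matrix $A$, the Seidel matrix of $G$ is $S=J_n-I_n-2A$, where $J_n$ is the all-ones $n\times n$ matrix and $I_n$ the identity. It is known that $\operatorname{rank} S\ge n-1$ always. Hence, when $S$ is singular, its nullspace is one-dimensional, and $\phi=\phi(G)=\phi(S)$ denotes the unique integer vector $\phi\in\mathbb{Z}^n$ with $S\phi=0$, with the greatest common divisor of its entries equal to $1$, and with first non-zero entry positive. -}

module Defs where

open import Level using (0ℓ)
open import Data.Bool.Base using (if_then_else_)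
open import Data.Nat.Base using (ℕ)
open import Data.Fin.Base as Fin using (Fin)
open import Data.Fin.Properties as Fin using ()
open import Data.Integer.Base as ℤ using (ℤ; +_; 0ℤ; 1ℤ)
open import Data.Integer.GCD using (gcd)
import Data.Integer.Properties as ℤ
open import Data.Product.Base using (_×_; ∃-syntax)
open import Data.Rational.Base as ℚ using (ℚ)
open import Data.Rational.Literals using (fromℤ)
import Data.Rational.Properties as ℚ
open import Data.Vec.Functional using (Vector; foldr)
open import Relation.Binary.Core using (Rel)
open import Relation.Binary.Definitions using (Symmetric; Irreflexive; Decidable)
open import Relation.Binary.PropositionalEquality.Core using (_≡_)
open import Relation.Nullary.Decidable.Core using (⌊_⌋)
open import Relation.Nullary.Negation.Core using (¬_)

import Algebra.Properties.CommutativeMonoid.Sum as Sum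

private
  module ℤΣ = Sum ℤ.+-0-commutativeMonoid
  module ℚΣ = Sum ℚ.+-0-commutativeMonoid

record Graph (n : ℕ) : Set₁ where
  infix 4 _~_ _~?_
  field
    _~_      : Rel (Fin n) 0ℓ
    ~-sym    : Symmetric _~_
    ~-irrefl : Irreflexive _≡_ _~_
    _~?_     : Decidable _~_

Matrix : Set → ℕ → Set
Matrix A n = Fin n → Fin n → A

adjacency : ∀ {n} → Graph n → Matrix ℤ n
adjacency G i j = if ⌊ i ~? j ⌋ then 1ℤ else 0ℤ
  where open Graph G

J : ∀ {n} → Matrix ℤ n
J i j = 1ℤ

I : ∀ {n} → Matrix ℤ n
I i j = if ⌊ i Fin.≟ j ⌋ then 1ℤ else 0ℤ

seidel : ∀ {n} → Graph n → Matrix ℤ n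
seidel G i j = J i j ℤ.- I i j ℤ.- + 2 ℤ.* adjacency G i j

infixl 7 _*ᵥ_ _*ₘ_

_*ᵥ_ : ∀ {n} → Matrix ℤ n → Vector ℤ n → Vector ℤ n
(M *ᵥ v) i = ℤΣ.sum (λ j → M i j ℤ.* v j)

_*ₘ_ : ∀ {n} → Matrix ℚ n → Matrix ℚ n → Matrix ℚ n
(M *ₘ N) i k = ℚΣ.sum (λ j → M i j ℚ.* N j k)

toℚ : ∀ {n} → Matrix ℤ n → Matrix ℚ n
toℚ M i j = fromℤ (M i j)

-- Invertibility is over the field ℚ, not over ℤ.  For an integer matrix
-- this agrees with invertibility over ℝ.
Invertible : ∀ {n} → Matrix ℤ n → Set
Invertible M = ∃[ B ]
  (∀ i j → (toℚ M *ₘ B) i j ≡ toℚ I i j) ×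
  (∀ i j → (B *ₘ toℚ M) i j ≡ toℚ I i j)

Singular : ∀ {n} → Matrix ℤ n → Set
Singular M = ¬ Invertible M

FirstNonzeroPositive : ∀ {n} → Vector ℤ n → Set
FirstNonzeroPositive v = ∃[ i ] (0ℤ ℤ.< v i) × (∀ j → j Fin.< i → v j ≡ 0ℤ)

-- The conditions that single out φ(S); uniqueness is not part of the record.
record IsPhi {n : ℕ} (S : Matrix ℤ n) (φ : Vector ℤ n) : Set where
  field
    null                 : ∀ i → (S *ᵥ φ) i ≡ 0ℤ
    gcd≡1                : foldr gcd 0ℤ φ ≡ 1ℤ
    firstNonzeroPositive : FirstNonzeroPositive φ

{-# OPTIONS --safe #-}
-- Blow-ups: if the Seidel matrix of H has zero row sums and each vertex k of H
-- is replaced by a graph G k with a null vector v k, all the v k having the same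
-- sum, then the v k together form a null vector of the blow-up.  The 5-cycle and
-- the circulant graph on ℤ/9 with connection set {±1, ±2} have zero Seidel row
-- sums, so iterated blow-ups give such graphs on p = 5^N and on q = 9^N vertices.
-- Blowing up the 5-cycle once more, with one fibre of p vertices of weight q and
-- four fibres of q vertices of weight p, gives a null vector whose entries are
-- the coprime numbers p and q.
--
-- Uniqueness is a 2-adic descent: a null vector vanishing at one vertex has only
-- even entries, and so does its half.
module Submission where

open import Data.Nat.Base using (ℕ; suc; _<_)
open import Data.Integer.Base using (∣_∣)
open import Data.Product.Base using (_×_; Σ-syntax; ∃-syntax)
open import Relation.Binary.PropositionalEquality using (_≗_)
open import Defs

open import Algebra.Bundles using (CommutativeRing)
import Algebra.Properties.Semiring.Sum as Sum
open import Data.Bool.Base using (Bool; if_then_else_)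
open import Data.Empty using (⊥-elim)
open import Data.Fin.Base as Fin using (Fin; zero; suc; toℕ; splitAt; _↑ˡ_; _↑ʳ_)
import Data.Fin.Properties as Fin
open import Data.Integer.Base as ℤ using (ℤ; +_; -_; 0ℤ; 1ℤ)
open import Data.Integer.GCD using (gcd)
import Data.Integer.Properties as ℤ
open import Data.Integer.Tactic.RingSolver using (solve-∀)
import Data.Nat.Base as ℕ
import Data.Nat.Properties as ℕ
open import Data.List.Base using (List; []; _∷_)
open import Data.List.Membership.DecPropositional ℕ._≟_ using (_∈?_)
open import Data.List.Membership.Propositional using (_∈_; _∉_)
open import Data.Nat.Coprimality as Coprime using (Coprime)
open import Data.Nat.Divisibility using (_∣_; 1∣_; *-monoʳ-∣; ∣⇒≤; ∣-trans)
import Data.Nat.GCD as ℕ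
open import Data.Product.Base using (_,_; proj₁; proj₂)
open import Data.Product.Properties using (≡-dec)
open import Data.Rational.Base as ℚ using (ℚ; 0ℚ)
open import Data.Rational.Literals using (fromℤ)
import Data.Rational.Properties as ℚ
open import Data.Sum.Base using (inj₁; inj₂)
open import Data.Unit.Base using (tt)
open import Data.Vec.Functional using (Vector; foldr)
open import Function.Base using (_∘_; const)
open import Function.Bundles using (_⇔_; mk⇔)
open import Relation.Binary.PropositionalEquality
  using (_≡_; _≢_; refl; sym; trans; cong; cong₂; subst; subst₂; module ≡-Reasoning)
open import Relation.Nullary.Decidable
  using (Dec; yes; no; ⌊_⌋; isYes≗does; does-⇔; ⌊⌋-map′; map′; from-yes; from-no)
open import Relation.Nullary.Negation using (¬_; contradiction)

private
  module ℤΣ = Sum ℤ.+-*-semiring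
  module ℚΣ = Sum (CommutativeRing.semiring ℚ.+-*-commutativeRing)

private variable
  m n t : ℕ

-- Null vectors of integer matrices.

⌊⌋-⇔ : {A B : Set} → A ⇔ B → (a? : Dec A) (b? : Dec B) → ⌊ a? ⌋ ≡ ⌊ b? ⌋
⌊⌋-⇔ A⇔B a? b? =
  trans (isYes≗does a?) (trans (does-⇔ A⇔B a? b?) (sym (isYes≗does b?)))

-- A record rather than a function, so that S and x can be inferred.
record Null (S : Matrix ℤ n) (x : Vector ℤ n) : Set where
  constructor mkNull
  field row : ∀ i → (S *ᵥ x) i ≡ 0ℤ

open Null

*ᵥ-scale : ∀ (S : Matrix ℤ n) a x i → (S *ᵥ (λ j → a ℤ.* x j)) i ≡ a ℤ.* (S *ᵥ x) i
*ᵥ-scale S a x i = begin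
  ℤΣ.sum (λ j → S i j ℤ.* (a ℤ.* x j))  ≡⟨ ℤΣ.sum-cong-≗ (λ j → swap (S i j) a (x j)) ⟩
  ℤΣ.sum (λ j → a ℤ.* (S i j ℤ.* x j))  ≡⟨ ℤΣ.*-distribˡ-sum a (λ j → S i j ℤ.* x j) ⟨
  a ℤ.* (S *ᵥ x) i                      ∎
  where
  open ≡-Reasoning
  swap : ∀ s a x → s ℤ.* (a ℤ.* x) ≡ a ℤ.* (s ℤ.* x)
  swap = solve-∀

*ᵥ-+ : ∀ (S : Matrix ℤ n) x y i → (S *ᵥ (λ j → x j ℤ.+ y j)) i ≡ (S *ᵥ x) i ℤ.+ (S *ᵥ y) i
*ᵥ-+ S x y i = trans
  (ℤΣ.sum-cong-≗ (λ j → ℤ.*-distribˡ-+ (S i j) (x j) (y j)))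
  (ℤΣ.∑-distrib-+ (λ j → S i j ℤ.* x j) (λ j → S i j ℤ.* y j))

Null-scale : ∀ {S : Matrix ℤ n} a {x} → Null S x → Null S (λ j → a ℤ.* x j)
Null-scale {S = S} a {x} Sx≡0 .row i =
  trans (*ᵥ-scale S a x i) (trans (cong (a ℤ.*_) (row Sx≡0 i)) (ℤ.*-zeroʳ a))

Null-+ : ∀ {S : Matrix ℤ n} {x y} → Null S x → Null S y → Null S (λ j → x j ℤ.+ y j)
Null-+ {S = S} {x} {y} Sx≡0 Sy≡0 .row i =
  trans (*ᵥ-+ S x y i) (cong₂ ℤ._+_ (row Sx≡0 i) (row Sy≡0 i))

Null-cong : ∀ {S : Matrix ℤ n} {x y} → x ≗ y → Null S x → Null S y
Null-cong {S = S} x≗y Sx≡0 .row i =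
  trans (ℤΣ.sum-cong-≗ (λ j → cong (S i j ℤ.*_) (sym (x≗y j)))) (row Sx≡0 i)

I*ᵥ : ∀ (x : Vector ℤ n) → I *ᵥ x ≗ x
I*ᵥ {suc n} x zero = begin
  1ℤ ℤ.* x zero ℤ.+ ℤΣ.sum (λ j → 0ℤ ℤ.* x (suc j))
    ≡⟨ cong₂ ℤ._+_ (ℤ.*-identityˡ (x zero))
         (trans (ℤΣ.sum-cong-≗ (λ j → ℤ.*-zeroˡ (x (suc j)))) (ℤΣ.sum-replicate-zero n)) ⟩
  x zero ℤ.+ 0ℤ  ≡⟨ ℤ.+-identityʳ (x zero) ⟩
  x zero         ∎
  where open ≡-Reasoning
I*ᵥ {suc n} x (suc i) = begin
  0ℤ ℤ.* x zero ℤ.+ ℤΣ.sum (λ j → I (suc i) (suc j) ℤ.* x (suc j))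
    ≡⟨ cong₂ ℤ._+_ (ℤ.*-zeroˡ (x zero))
         -- The decision for `suc i` and `suc j` is a `map′` of the one for `i` and `j`, so its
         -- Boolean is the same.
         (ℤΣ.sum-cong-≗ (λ j → cong (λ b → (if b then 1ℤ else 0ℤ) ℤ.* x (suc j))
           (⌊⌋-map′ _ _ (i Fin.≟ j)))) ⟩
  0ℤ ℤ.+ (I *ᵥ (x ∘ suc)) i  ≡⟨ ℤ.+-identityˡ ((I *ᵥ (x ∘ suc)) i) ⟩
  (I *ᵥ (x ∘ suc)) i         ≡⟨ I*ᵥ (x ∘ suc) i ⟩
  x (suc i)                  ∎
  where open ≡-Reasoning

-- Singularity over ℚ.

fromℤ-+ : ∀ a b → fromℤ (a ℤ.+ b) ≡ fromℤ a ℚ.+ fromℤ b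
fromℤ-+ a b = sym (trans
  -- Addition in ℚ normalises (a·1 + b·1)/(1·1); the factors 1 come from the denominators.
  (cong (ℚ._/ 1) (cong₂ ℤ._+_ (ℤ.*-identityʳ a) (ℤ.*-identityʳ b)))
  (ℚ.↥p/↧p≡p (fromℤ (a ℤ.+ b))))

fromℤ-* : ∀ a b → fromℤ (a ℤ.* b) ≡ fromℤ a ℚ.* fromℤ b
fromℤ-* a b = sym (ℚ.↥p/↧p≡p (fromℤ (a ℤ.* b)))

fromℤ-sum : ∀ (x : Vector ℤ n) → fromℤ (ℤΣ.sum x) ≡ ℚΣ.sum (fromℤ ∘ x)
fromℤ-sum {ℕ.zero} x = refl
fromℤ-sum {suc n} x =
  trans (fromℤ-+ (x zero) _) (cong (fromℤ (x zero) ℚ.+_) (fromℤ-sum (x ∘ suc)))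

fromℤ-*ᵥ : ∀ (M : Matrix ℤ n) x i →
           fromℤ ((M *ᵥ x) i) ≡ ℚΣ.sum (λ j → toℚ M i j ℚ.* fromℤ (x j))
fromℤ-*ᵥ M x i = trans (fromℤ-sum (λ j → M i j ℤ.* x j))
  (ℚΣ.sum-cong-≗ (λ j → fromℤ-* (M i j) (x j)))

-- A left inverse B would give x = (BS)x = B(Sx) = 0 over ℚ.
Null⇒Singular : ∀ {S : Matrix ℤ n} {x} → Null S x → ∀ {i} → x i ≢ 0ℤ → Singular S
Null⇒Singular {n} {S} {x} Sx≡0 {i} xᵢ≢0 (B , _ , BS≡I) = xᵢ≢0 (cong ℚ.numerator fromℤxᵢ≡0)
  where
  open ≡-Reasoning
  q : Vector ℚ n
  q = fromℤ ∘ x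
  fromℤxᵢ≡0 : q i ≡ 0ℚ
  fromℤxᵢ≡0 = begin
    q i
      ≡⟨ cong fromℤ (I*ᵥ x i) ⟨
    fromℤ ((I *ᵥ x) i)
      ≡⟨ fromℤ-*ᵥ I x i ⟩
    ℚΣ.sum (λ j → toℚ I i j ℚ.* q j)
      ≡⟨ ℚΣ.sum-cong-≗ (λ j → cong (ℚ._* q j) (sym (BS≡I i j))) ⟩
    ℚΣ.sum (λ j → (B *ₘ toℚ S) i j ℚ.* q j)
      ≡⟨ ℚΣ.sum-cong-≗ (λ j → ℚΣ.*-distribʳ-sum (q j) (λ k → B i k ℚ.* toℚ S k j)) ⟩
    ℚΣ.sum (λ j → ℚΣ.sum (λ k → B i k ℚ.* toℚ S k j ℚ.* q j))
      ≡⟨ ℚΣ.∑-comm (λ j k → B i k ℚ.* toℚ S k j ℚ.* q j) ⟩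
    ℚΣ.sum (λ k → ℚΣ.sum (λ j → B i k ℚ.* toℚ S k j ℚ.* q j))
      ≡⟨ ℚΣ.sum-cong-≗ summand≡0 ⟩
    ℚΣ.sum {n} (const 0ℚ)
      ≡⟨ ℚΣ.sum-replicate-zero n ⟩
    0ℚ ∎
    where
    summand≡0 : ∀ k → ℚΣ.sum (λ j → B i k ℚ.* toℚ S k j ℚ.* q j) ≡ 0ℚ
    summand≡0 k = begin
      ℚΣ.sum (λ j → B i k ℚ.* toℚ S k j ℚ.* q j)
        ≡⟨ ℚΣ.sum-cong-≗ (λ j → ℚ.*-assoc (B i k) (toℚ S k j) (q j)) ⟩
      ℚΣ.sum (λ j → B i k ℚ.* (toℚ S k j ℚ.* q j))
        ≡⟨ ℚΣ.*-distribˡ-sum (B i k) (λ j → toℚ S k j ℚ.* q j) ⟨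
      B i k ℚ.* ℚΣ.sum (λ j → toℚ S k j ℚ.* q j)
        ≡⟨ cong (B i k ℚ.*_) (fromℤ-*ᵥ S x k) ⟨
      B i k ℚ.* fromℤ ((S *ᵥ x) k)
        ≡⟨ cong (λ z → B i k ℚ.* fromℤ z) (row Sx≡0 k) ⟩
      B i k ℚ.* 0ℚ
        ≡⟨ ℚ.*-zeroʳ (B i k) ⟩
      0ℚ ∎

-- The 2-adic descent.

sum≡x+Sx+2Ax : ∀ (G : Graph n) x i →
  ℤΣ.sum x ≡ x i ℤ.+ (seidel G *ᵥ x) i ℤ.+ + 2 ℤ.* (adjacency G *ᵥ x) i
sum≡x+Sx+2Ax G x i = begin
  ℤΣ.sum x
    ≡⟨ ℤΣ.sum-cong-≗ (λ j → split (I i j) (adjacency G i j) (x j)) ⟩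
  ℤΣ.sum (λ j → I i j ℤ.* x j ℤ.+ seidel G i j ℤ.* x j ℤ.+ + 2 ℤ.* (adjacency G i j ℤ.* x j))
    ≡⟨ ℤΣ.∑-distrib-+ (λ j → I i j ℤ.* x j ℤ.+ seidel G i j ℤ.* x j) _ ⟩
  ℤΣ.sum (λ j → I i j ℤ.* x j ℤ.+ seidel G i j ℤ.* x j) ℤ.+
  ℤΣ.sum (λ j → + 2 ℤ.* (adjacency G i j ℤ.* x j))
    ≡⟨ cong₂ ℤ._+_ (ℤΣ.∑-distrib-+ (λ j → I i j ℤ.* x j) _)
         (sym (ℤΣ.*-distribˡ-sum (+ 2) (λ j → adjacency G i j ℤ.* x j))) ⟩
  (I *ᵥ x) i ℤ.+ (seidel G *ᵥ x) i ℤ.+ + 2 ℤ.* (adjacency G *ᵥ x) i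
    ≡⟨ cong (λ z → z ℤ.+ (seidel G *ᵥ x) i ℤ.+ + 2 ℤ.* (adjacency G *ᵥ x) i) (I*ᵥ x i) ⟩
  x i ℤ.+ (seidel G *ᵥ x) i ℤ.+ + 2 ℤ.* (adjacency G *ᵥ x) i ∎
  where
  open ≡-Reasoning
  -- One entry of J = I + S + 2A, multiplied by an entry of x.
  split : ∀ d a x → x ≡ d ℤ.* x ℤ.+ (1ℤ ℤ.- d ℤ.- + 2 ℤ.* a) ℤ.* x ℤ.+ + 2 ℤ.* (a ℤ.* x)
  split = solve-∀

-- Modulo 2 the Seidel matrix is J - I, so the entries of a null vector are
-- congruent to their sum, hence to each other.
null-halve : ∀ (G : Graph (suc n)) {x} → Null (seidel G) x → x zero ≡ 0ℤ →
             ∃[ y ] (∀ i → x i ≡ + 2 ℤ.* y i)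
-- With a = Ax, the quantity x i + 2 a i equals the sum of x for every i. Comparing i with `zero`,
-- where x vanishes, gives x i = 2 (a zero - a i).
null-halve G {x} Sx≡0 x₀≡0 = (λ i → a zero ℤ.- a i) , λ i → begin
  x i                                          ≡⟨ isolate (x i) (a i) ⟩
  x i ℤ.+ 0ℤ ℤ.+ + 2 ℤ.* a i ℤ.- + 2 ℤ.* a i   ≡⟨ cong (ℤ._- + 2 ℤ.* a i) (sum≡ i) ⟨
  ℤΣ.sum x ℤ.- + 2 ℤ.* a i                     ≡⟨ cong (ℤ._- + 2 ℤ.* a i) (sum≡ zero) ⟩
  x zero ℤ.+ 0ℤ ℤ.+ + 2 ℤ.* a zero ℤ.- + 2 ℤ.* a i
    ≡⟨ cong (λ z → z ℤ.+ 0ℤ ℤ.+ + 2 ℤ.* a zero ℤ.- + 2 ℤ.* a i) x₀≡0 ⟩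
  0ℤ ℤ.+ 0ℤ ℤ.+ + 2 ℤ.* a zero ℤ.- + 2 ℤ.* a i ≡⟨ factor (a zero) (a i) ⟩
  + 2 ℤ.* (a zero ℤ.- a i)                     ∎
  where
  open ≡-Reasoning
  a = adjacency G *ᵥ x
  isolate : ∀ x a → x ≡ x ℤ.+ 0ℤ ℤ.+ + 2 ℤ.* a ℤ.- + 2 ℤ.* a
  isolate = solve-∀
  factor : ∀ u v → 0ℤ ℤ.+ 0ℤ ℤ.+ + 2 ℤ.* u ℤ.- + 2 ℤ.* v ≡ + 2 ℤ.* (u ℤ.- v)
  factor = solve-∀
  sum≡ : ∀ i → ℤΣ.sum x ≡ x i ℤ.+ 0ℤ ℤ.+ + 2 ℤ.* a i
  sum≡ i = trans (sum≡x+Sx+2Ax G x i) (cong (λ z → x i ℤ.+ z ℤ.+ + 2 ℤ.* a i) (row Sx≡0 i))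

null-2^k∣ : ∀ (G : Graph (suc n)) k {x} → Null (seidel G) x → x zero ≡ 0ℤ →
            ∀ i → 2 ℕ.^ k ∣ ∣ x i ∣
null-2^k∣ G ℕ.zero _ _ i = 1∣ _
null-2^k∣ {n} G (suc k) {x} Sx≡0 x₀≡0 i with y , x≡2y ← null-halve G Sx≡0 x₀≡0 =
  subst (2 ℕ.* 2 ℕ.^ k ∣_) (sym (trans (cong ∣_∣ (x≡2y i)) (ℤ.abs-* (+ 2) (y i))))
    (*-monoʳ-∣ 2 (null-2^k∣ G k Sy≡0 y₀≡0 i))
  where
  open ≡-Reasoning
  y₀≡0 : y zero ≡ 0ℤ
  y₀≡0 = ℤ.*-cancelˡ-≡ (+ 2) (y zero) 0ℤ (trans (sym (x≡2y zero)) x₀≡0)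
  Sy≡0 : Null (seidel G) y
  Sy≡0 .row i = ℤ.*-cancelˡ-≡ (+ 2) ((seidel G *ᵥ y) i) 0ℤ (begin
    + 2 ℤ.* (seidel G *ᵥ y) i            ≡⟨ *ᵥ-scale (seidel G) (+ 2) y i ⟨
    (seidel G *ᵥ (λ j → + 2 ℤ.* y j)) i  ≡⟨ row (Null-cong x≡2y Sx≡0) i ⟩
    0ℤ                                   ∎)

n<m^n : 1 < m → ∀ n → n < m ℕ.^ n
n<m^n             1<m ℕ.zero  = ℕ.z<s
-- The induction hypothesis is used as 1 + n ≤ m^n; strictness comes from m^n < m^(1 + n).
n<m^n {m = m} 1<m (suc n) = ℕ.≤-<-trans (n<m^n 1<m n) (ℕ.^-monoʳ-< m 1<m (ℕ.n<1+n n))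

null-head≡0 : ∀ (G : Graph (suc n)) {x} → Null (seidel G) x → x zero ≡ 0ℤ → ∀ i → x i ≡ 0ℤ
-- With a = `∣ x i ∣`, descending a times yields 2^a ∣ a, which a < 2^a allows only for a = 0.
null-head≡0 G {x} Sx≡0 x₀≡0 i = ℤ.∣i∣≡0⇒i≡0 (small ∣ x i ∣ (null-2^k∣ G ∣ x i ∣ Sx≡0 x₀≡0 i))
  where
  small : ∀ a → 2 ℕ.^ a ∣ a → a ≡ 0
  small ℕ.zero    _     = refl
  small a@(suc _) 2^a∣a =
    contradiction (n<m^n (ℕ.s<s ℕ.z<s) a) (ℕ.≤⇒≯ (∣⇒≤ 2^a∣a))

-- Uniqueness of φ.

foldr-gcd-scale : ∀ a b (u v : Vector ℤ n) → (∀ i → a ℤ.* u i ≡ b ℤ.* v i) →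
  ∣ a ∣ ℕ.* ∣ foldr gcd 0ℤ u ∣ ≡ ∣ b ∣ ℕ.* ∣ foldr gcd 0ℤ v ∣
foldr-gcd-scale {ℕ.zero} a b u v au≡bv = trans (ℕ.*-zeroʳ ∣ a ∣) (sym (ℕ.*-zeroʳ ∣ b ∣))
foldr-gcd-scale {suc n} a b u v au≡bv = begin
  -- The scalars move inside, so both sides become the gcd of the common vector au = bv.
  ∣ a ∣ ℕ.* ℕ.gcd u₀ gᵤ              ≡⟨ ℕ.c*gcd[m,n]≡gcd[cm,cn] (∣ a ∣) u₀ gᵤ ⟩
  ℕ.gcd (∣ a ∣ ℕ.* u₀) (∣ a ∣ ℕ.* gᵤ) ≡⟨ cong₂ ℕ.gcd heads tails ⟩
  ℕ.gcd (∣ b ∣ ℕ.* v₀) (∣ b ∣ ℕ.* gᵥ) ≡⟨ ℕ.c*gcd[m,n]≡gcd[cm,cn] (∣ b ∣) v₀ gᵥ ⟨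
  ∣ b ∣ ℕ.* ℕ.gcd v₀ gᵥ              ∎
  where
  open ≡-Reasoning
  u₀ = ∣ u zero ∣
  v₀ = ∣ v zero ∣
  gᵤ = ∣ foldr gcd 0ℤ (u ∘ suc) ∣
  gᵥ = ∣ foldr gcd 0ℤ (v ∘ suc) ∣
  heads : ∣ a ∣ ℕ.* u₀ ≡ ∣ b ∣ ℕ.* v₀
  heads = trans (sym (ℤ.abs-* a (u zero))) (trans (cong ∣_∣ (au≡bv zero)) (ℤ.abs-* b (v zero)))
  tails : ∣ a ∣ ℕ.* gᵤ ≡ ∣ b ∣ ℕ.* gᵥ
  tails = foldr-gcd-scale a b (u ∘ suc) (v ∘ suc) (au≡bv ∘ suc)

-- If the first positive entry came later, `φ zero` would vanish, and by `null-head≡0` so would that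
-- entry.
IsPhi-head>0 : ∀ (G : Graph (suc n)) {φ} → IsPhi (seidel G) φ → 0ℤ ℤ.< φ zero
IsPhi-head>0 G {φ} φ-phi with IsPhi.firstNonzeroPositive φ-phi
... | zero  , 0<φ₀ , _      = 0<φ₀
... | suc k , 0<φₖ , before =
  contradiction (subst (0ℤ ℤ.<_) (null-head≡0 G {φ} (mkNull (IsPhi.null φ-phi)) (before zero ℕ.z<s) (suc k)) 0<φₖ)
    (ℤ.<-irrefl refl)

-- The combination ψ₀φ - φ₀ψ is a null vector vanishing at vertex `zero`, hence it is 0. Taking gcds
-- in ψ₀φ = φ₀ψ gives equal absolute values of φ₀ and ψ₀, positivity fixes the sign, and φ₀ can be
-- cancelled.
IsPhi-unique : ∀ (G : Graph (suc n)) {φ ψ} → IsPhi (seidel G) φ → IsPhi (seidel G) ψ → φ ≗ ψ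
IsPhi-unique {n} G {φ} {ψ} φ-phi ψ-phi i =
  ℤ.*-cancelˡ-≡ (φ zero) (φ i) (ψ i) {{ℤ.>-nonZero φ₀>0}}
    (trans (cong (ℤ._* φ i) φ₀≡ψ₀) (proportional i))
  where
  open ≡-Reasoning
  φ₀>0 = IsPhi-head>0 G φ-phi
  ψ₀>0 = IsPhi-head>0 G ψ-phi
  z : Vector ℤ (suc n)
  z j = ψ zero ℤ.* φ j ℤ.+ (- φ zero) ℤ.* ψ j
  z₀≡0 : z zero ≡ 0ℤ
  z₀≡0 = lemma (ψ zero) (φ zero)
    where
    lemma : ∀ p q → p ℤ.* q ℤ.+ (- q) ℤ.* p ≡ 0ℤ
    lemma = solve-∀
  z≡0 : ∀ j → z j ≡ 0ℤ
  z≡0 = null-head≡0 G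
    (Null-+ (Null-scale (ψ zero) (mkNull (IsPhi.null φ-phi)))
            (Null-scale (- φ zero) (mkNull (IsPhi.null ψ-phi))))
    z₀≡0
  proportional : ∀ j → ψ zero ℤ.* φ j ≡ φ zero ℤ.* ψ j
  proportional j = ℤ.i-j≡0⇒i≡j _ _
    (trans (lemma (ψ zero ℤ.* φ j) (φ zero) (ψ j)) (z≡0 j))
    where
    lemma : ∀ p q r → p ℤ.- q ℤ.* r ≡ p ℤ.+ (- q) ℤ.* r
    lemma = solve-∀
  ∣ψ₀∣≡∣φ₀∣ : ∣ ψ zero ∣ ≡ ∣ φ zero ∣
  ∣ψ₀∣≡∣φ₀∣ = begin
    ∣ ψ zero ∣                               ≡⟨ ℕ.*-identityʳ _ ⟨
    ∣ ψ zero ∣ ℕ.* 1                         ≡⟨ cong (λ g → ∣ ψ zero ∣ ℕ.* ∣ g ∣) (IsPhi.gcd≡1 φ-phi) ⟨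
    ∣ ψ zero ∣ ℕ.* ∣ foldr gcd 0ℤ φ ∣        ≡⟨ foldr-gcd-scale (ψ zero) (φ zero) φ ψ proportional ⟩
    ∣ φ zero ∣ ℕ.* ∣ foldr gcd 0ℤ ψ ∣        ≡⟨ cong (λ g → ∣ φ zero ∣ ℕ.* ∣ g ∣) (IsPhi.gcd≡1 ψ-phi) ⟩
    ∣ φ zero ∣ ℕ.* 1                         ≡⟨ ℕ.*-identityʳ _ ⟩
    ∣ φ zero ∣                               ∎
  φ₀≡ψ₀ : φ zero ≡ ψ zero
  φ₀≡ψ₀ = begin
    φ zero        ≡⟨ ℤ.0≤i⇒+∣i∣≡i (ℤ.<⇒≤ φ₀>0) ⟨
    + ∣ φ zero ∣  ≡⟨ cong +_ ∣ψ₀∣≡∣φ₀∣ ⟨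
    + ∣ ψ zero ∣  ≡⟨ ℤ.0≤i⇒+∣i∣≡i (ℤ.<⇒≤ ψ₀>0) ⟩
    ψ zero        ∎

-- Index sets of blow-ups and sums over them.

total : (Fin t → ℕ) → ℕ
total s = foldr ℕ._+_ 0 s

-- Adjacency and weights of a blow-up are natural on pairs of a fibre and a position in it; `decode`
-- and `encode` identify these pairs with the numbered vertices that `Graph` demands.
decode : (s : Fin t → ℕ) → Fin (total s) → Σ[ k ∈ Fin t ] Fin (s k)
decode {suc t} s i with splitAt (s zero) i
... | inj₁ x = zero , x
... | inj₂ j = let k , x = decode (s ∘ suc) j in suc k , x

encode : (s : Fin t → ℕ) → Σ[ k ∈ Fin t ] Fin (s k) → Fin (total s)
encode s (zero  , x) = x ↑ˡ total (s ∘ suc)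
encode s (suc k , x) = s zero ↑ʳ encode (s ∘ suc) (k , x)

encode-decode : ∀ (s : Fin t → ℕ) i → encode s (decode s i) ≡ i
encode-decode {suc t} s i with splitAt (s zero) i in eq
... | inj₁ x = Fin.splitAt⁻¹-↑ˡ eq
... | inj₂ j = trans (cong (s zero ↑ʳ_) (encode-decode (s ∘ suc) j)) (Fin.splitAt⁻¹-↑ʳ eq)

decode-encode : ∀ (s : Fin t → ℕ) p → decode s (encode s p) ≡ p
decode-encode s (zero  , x) rewrite Fin.splitAt-↑ˡ (s zero) x (total (s ∘ suc)) = refl
decode-encode s (suc k , x)
  rewrite Fin.splitAt-↑ʳ (s zero) (total (s ∘ suc)) (encode (s ∘ suc) (k , x))
        | decode-encode (s ∘ suc) (k , x) = refl

decode-injective : ∀ (s : Fin t → ℕ) {i j} → decode s i ≡ decode s j → i ≡ j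
decode-injective s {i} {j} eq =
  trans (sym (encode-decode s i)) (trans (cong (encode s) eq) (encode-decode s j))

sum-split : ∀ m (f : Vector ℤ (m ℕ.+ n)) →
            ℤΣ.sum f ≡ ℤΣ.sum (f ∘ (_↑ˡ n)) ℤ.+ ℤΣ.sum (f ∘ (m ↑ʳ_))
sum-split ℕ.zero    f = sym (ℤ.+-identityˡ _)
sum-split (suc m) f =
  trans (cong₂ ℤ._+_ (refl {x = f zero}) (sum-split m (f ∘ suc))) (sym (ℤ.+-assoc (f zero) _ _))

-- Fibre `zero` is numbered first, so the sum splits into that block and, recursively, the other
-- fibres.
sum-decode : ∀ (s : Fin t → ℕ) (f : Σ[ k ∈ Fin t ] Fin (s k) → ℤ) →
             ℤΣ.sum (f ∘ decode s) ≡ ℤΣ.sum (λ k → ℤΣ.sum (λ x → f (k , x)))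
sum-decode {ℕ.zero}  s f = refl
sum-decode {suc t} s f = trans (sum-split (s zero) (f ∘ decode s))
  (cong₂ ℤ._+_
    (ℤΣ.sum-cong-≗ (λ x → cong f (decode-encode s (zero , x))))
    (trans (ℤΣ.sum-cong-≗ tail) (sum-decode (s ∘ suc) (λ (k , x) → f (suc k , x)))))
  where
  tail : ∀ j → f (decode s (s zero ↑ʳ j)) ≡
               (λ (k , x) → f (suc k , x)) (decode (s ∘ suc) j)
  tail j rewrite Fin.splitAt-↑ʳ (s zero) (total (s ∘ suc)) j = refl

sum-const : ∀ n a → ℤΣ.sum {n} (const a) ≡ + n ℤ.* a
sum-const ℕ.zero  a = sym (ℤ.*-zeroˡ a)
sum-const (suc n) a = begin
  a ℤ.+ ℤΣ.sum {n} (const a)   ≡⟨ cong₂ ℤ._+_ (refl {x = a}) (sum-const n a) ⟩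
  a ℤ.+ + n ℤ.* a              ≡⟨ ℤ.suc-* (+ n) a ⟨
  (1ℤ ℤ.+ + n) ℤ.* a           ∎
  where open ≡-Reasoning

-- Blow-ups and their null vectors.

seidelEntry : Bool → Bool → ℤ
seidelEntry same adjacent =
  1ℤ ℤ.- (if same then 1ℤ else 0ℤ) ℤ.- + 2 ℤ.* (if adjacent then 1ℤ else 0ℤ)

seidel-diagonal : ∀ (G : Graph n) i → seidel G i i ≡ 0ℤ
seidel-diagonal G i = cong₂ seidelEntry
  -- Comparison with the explicit decisions `yes tt` and `no` fixes both Booleans, leaving 1 - 1 -
  -- 2·0.
  (⌊⌋-⇔ (mk⇔ _ (λ _ → refl)) (i Fin.≟ i) (yes tt))
  (⌊⌋-⇔ (mk⇔ (λ i~i → ~-irrefl refl i~i) ⊥-elim) (i ~? i) (no λ ()))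
  where
  open Graph G

module BlowUp (H : Graph t) (s : Fin t → ℕ) (G : ∀ k → Graph (s k)) where

  Vertex : Set
  Vertex = Σ[ k ∈ Fin t ] Fin (s k)

  -- Irreflexivity of `H` confines `across` to pairs in distinct fibres.
  data Adjacent : Vertex → Vertex → Set where
    within : ∀ {k x y} → Graph._~_ (G k) x y → Adjacent (k , x) (k , y)
    across : ∀ {k l x y} → Graph._~_ H k l → Adjacent (k , x) (l , y)

  within⁻¹ : ∀ {k x y} → Adjacent (k , x) (k , y) → Graph._~_ (G k) x y
  within⁻¹ (within x~y) = x~y
  within⁻¹ (across k~k) = contradiction k~k (Graph.~-irrefl H refl)

  across⁻¹ : ∀ {k l x y} → k ≢ l → Adjacent (k , x) (l , y) → Graph._~_ H k l
  across⁻¹ k≢k (within _)   = contradiction refl k≢k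
  across⁻¹ _   (across k~l) = k~l

  adjacent? : ∀ p q → Dec (Adjacent p q)
  adjacent? (k , x) (l , y) with k Fin.≟ l
  ... | yes refl = map′ within within⁻¹ (Graph._~?_ (G k) x y)
  ... | no k≢l   = map′ across (across⁻¹ k≢l) (Graph._~?_ H k l)

  adjacent-sym : ∀ {p q} → Adjacent p q → Adjacent q p
  adjacent-sym (within {k} x~y) = within (Graph.~-sym (G k) x~y)
  adjacent-sym (across k~l)     = across (Graph.~-sym H k~l)

  adjacent-irrefl : ∀ {p q} → p ≡ q → ¬ Adjacent p q
  adjacent-irrefl {k , _} refl p~p = Graph.~-irrefl (G k) refl (within⁻¹ p~p)

  graph : Graph (total s)
  graph = record
    { _~_      = λ i j → Adjacent (decode s i) (decode s j)
    ; ~-sym    = adjacent-sym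
    ; ~-irrefl = adjacent-irrefl ∘ cong (decode s)
    ; _~?_     = λ i j → adjacent? (decode s i) (decode s j)
    }

  _≟_ : (p q : Vertex) → Dec (p ≡ q)
  _≟_ = ≡-dec Fin._≟_ Fin._≟_

  -- The Seidel entry read on pairs. It depends on two Booleans only, so equivalences of
  -- propositions suffice to match it with entries of `G k` or `H`.
  entry : Vertex → Vertex → ℤ
  entry p q = seidelEntry ⌊ p ≟ q ⌋ ⌊ adjacent? p q ⌋

  seidel-graph : ∀ i j → seidel graph i j ≡ entry (decode s i) (decode s j)
  seidel-graph i j = cong (λ b → seidelEntry b ⌊ adjacent? (decode s i) (decode s j) ⌋)
    (⌊⌋-⇔ (mk⇔ (cong (decode s)) (decode-injective s)) (i Fin.≟ j) (decode s i ≟ decode s j))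

  entry-within : ∀ k x y → entry (k , x) (k , y) ≡ seidel (G k) x y
  entry-within k x y = cong₂ seidelEntry
    (⌊⌋-⇔ (mk⇔ (λ { refl → refl }) (cong (k ,_))) ((k , x) ≟ (k , y)) (x Fin.≟ y))
    (⌊⌋-⇔ (mk⇔ within⁻¹ within) (adjacent? (k , x) (k , y)) (Graph._~?_ (G k) x y))

  entry-across : ∀ {k l} x y → k ≢ l → entry (k , x) (l , y) ≡ seidel H k l
  entry-across {k} {l} x y k≢l = cong₂ seidelEntry
    (⌊⌋-⇔ (mk⇔ (cong proj₁) (λ k≡l → contradiction k≡l k≢l)) ((k , x) ≟ (l , y)) (k Fin.≟ l))
    (⌊⌋-⇔ (mk⇔ (across⁻¹ k≢l) across) (adjacent? (k , x) (l , y)) (Graph._~?_ H k l))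

  -- In a row of fibre k, another fibre l has constant entries and contributes `seidel H k l` times
  -- c. Fibre k itself contributes 0, which fits the same formula because the diagonal of `seidel H`
  -- is 0. The total is c times a row sum of `seidel H`.
  null : ∀ (v : ∀ k → Vector ℤ (s k)) c →
         Null (seidel H) (const 1ℤ) →
         (∀ k → Null (seidel (G k)) (v k)) →
         (∀ k → ℤΣ.sum (v k) ≡ c) →
         Null (seidel graph) (λ i → let k , x = decode s i in v k x)
  null v c H1≡0 Gv≡0 Σv≡c .row i = begin
    ℤΣ.sum (λ j → seidel graph i j ℤ.* w (decode s j))
      ≡⟨ ℤΣ.sum-cong-≗ (λ j → cong (ℤ._* w (decode s j)) (seidel-graph i j)) ⟩
    ℤΣ.sum (λ j → entry p (decode s j) ℤ.* w (decode s j))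
      ≡⟨ sum-decode s (λ q → entry p q ℤ.* w q) ⟩
    ℤΣ.sum (λ l → ℤΣ.sum (λ y → entry p (l , y) ℤ.* v l y))
      ≡⟨ ℤΣ.sum-cong-≗ (λ l → fibre l (k Fin.≟ l)) ⟩
    ℤΣ.sum (λ l → seidel H k l ℤ.* c)
      ≡⟨ ℤΣ.sum-cong-≗ (λ l → cong (seidel H k l ℤ.*_) (ℤ.*-identityʳ c)) ⟨
    (seidel H *ᵥ (λ l → c ℤ.* 1ℤ)) k
      ≡⟨ row (Null-scale c H1≡0) k ⟩
    0ℤ ∎
    where
    open ≡-Reasoning
    p = decode s i
    k = proj₁ p
    x = proj₂ p
    w : Vertex → ℤ
    w (k , x) = v k x
    fibre : ∀ l → Dec (k ≡ l) →
            ℤΣ.sum (λ y → entry p (l , y) ℤ.* v l y) ≡ seidel H k l ℤ.* c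
    fibre l (yes refl) = begin
      ℤΣ.sum (λ y → entry (k , x) (k , y) ℤ.* v k y)
        ≡⟨ ℤΣ.sum-cong-≗ (λ y → cong (ℤ._* v k y) (entry-within k x y)) ⟩
      (seidel (G k) *ᵥ v k) x  ≡⟨ row (Gv≡0 k) x ⟩
      0ℤ                       ≡⟨ ℤ.*-zeroˡ c ⟨
      0ℤ ℤ.* c                 ≡⟨ cong (ℤ._* c) (seidel-diagonal H k) ⟨
      seidel H k k ℤ.* c       ∎
    fibre l (no k≢l) = begin
      ℤΣ.sum (λ y → entry (k , x) (l , y) ℤ.* v l y)
        ≡⟨ ℤΣ.sum-cong-≗ (λ y → cong (ℤ._* v l y) (entry-across x y k≢l)) ⟩
      ℤΣ.sum (λ y → seidel H k l ℤ.* v l y)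
        ≡⟨ ℤΣ.*-distribˡ-sum (seidel H k l) (v l) ⟨
      seidel H k l ℤ.* ℤΣ.sum (v l)
        ≡⟨ cong (seidel H k l ℤ.*_) (Σv≡c l) ⟩
      seidel H k l ℤ.* c ∎

-- Graphs with zero Seidel row sums.

Balanced : ℕ → Set₁
Balanced n = Σ[ G ∈ Graph n ] Null (seidel G) (const 1ℤ)

-- Distances are not reduced modulo n, so a circulant graph arises when D lists n - d along with
-- each d.
distanceGraph : (n : ℕ) (D : List ℕ) → 0 ∉ D → Graph n
distanceGraph n D 0∉D = record
  { _~_      = λ i j → ℕ.∣ toℕ i - toℕ j ∣ ∈ D
  ; ~-sym    = λ {i} {j} → subst (_∈ D) (ℕ.∣-∣-comm (toℕ i) (toℕ j))
  ; ~-irrefl = λ { {i} refl d∈D → 0∉D (subst (_∈ D) (ℕ.∣n-n∣≡0 (toℕ i)) d∈D) }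
  ; _~?_     = λ i j → ℕ.∣ toℕ i - toℕ j ∣ ∈? D
  }

-- A row sum is n - 1 - 2·degree, so each vertex must be adjacent to half of the others: 2 of 4
-- here, 4 of 8 in `balanced₉`.
balanced₅ : Balanced 5
balanced₅ = G , mkNull (from-yes (Fin.all? λ i → (seidel G *ᵥ const 1ℤ) i ℤ.≟ 0ℤ))
  where
  D = 1 ∷ 4 ∷ []
  G = distanceGraph 5 D (from-no (0 ∈? D))

balanced₉ : Balanced 9
balanced₉ = G , mkNull (from-yes (Fin.all? λ i → (seidel G *ᵥ const 1ℤ) i ℤ.≟ 0ℤ))
  where
  D = 1 ∷ 2 ∷ 7 ∷ 8 ∷ []
  G = distanceGraph 9 D (from-no (0 ∈? D))

total-const : ∀ t n → total {t} (const n) ≡ t ℕ.* n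
total-const ℕ.zero  n = refl
total-const (suc t) n = cong (n ℕ.+_) (total-const t n)

-- Equal fibres with the all-ones vector have equal sums, so `null` applies; the order of the
-- blow-up equals t·n only up to `total-const`, hence the `subst`.
balanced-* : Balanced t → Balanced n → Balanced (t ℕ.* n)
balanced-* {t} {n} (H , H1≡0) (G , G1≡0) = subst Balanced (total-const t n)
  (graph , null (λ _ _ → 1ℤ) _ H1≡0 (λ _ → G1≡0) (λ _ → refl))
  where open BlowUp H (const n) (const G)

balanced-1 : Balanced 1
balanced-1 = distanceGraph 1 [] (λ ()) , mkNull λ { zero → refl }

balanced-^ : Balanced t → ∀ k → Balanced (t ℕ.^ k)
balanced-^ b ℕ.zero  = balanced-1
balanced-^ b (suc k) = balanced-* b (balanced-^ b k)

-- Coprime powers and gcds of vectors.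

coprime-^ʳ : Coprime m n → ∀ k → Coprime m (n ℕ.^ k)
coprime-^ʳ c ℕ.zero  = Coprime.sym (Coprime.1-coprimeTo _)
coprime-^ʳ c (suc k) (d∣m , d∣n^1+k) = coprime-^ʳ c k
  -- As a divisor of m, d is coprime to n, so d ∣ n·n^k implies d ∣ n^k.
  (d∣m , Coprime.coprime-divisor (λ (e∣d , e∣n) → c (∣-trans e∣d d∣m , e∣n)) d∣n^1+k)

foldr-gcd-∣ : ∀ (v : Vector ℤ n) i → ∣ foldr gcd 0ℤ v ∣ ∣ ∣ v i ∣
foldr-gcd-∣ v zero    = ℕ.gcd[m,n]∣m (∣ v zero ∣) _
foldr-gcd-∣ v (suc i) = ∣-trans (ℕ.gcd[m,n]∣n (∣ v zero ∣) _) (foldr-gcd-∣ (v ∘ suc) i)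

-- The gcd of all entries is a common divisor of the two coprime ones.
foldr-gcd≡1 : ∀ (v : Vector ℤ n) i j → Coprime (∣ v i ∣) (∣ v j ∣) → foldr gcd 0ℤ v ≡ 1ℤ
foldr-gcd≡1 {suc _} v i j c = cong +_ (c (foldr-gcd-∣ v i , foldr-gcd-∣ v j))

-- The blow-up with weights 5^N and 9^N.

module Example (N : ℕ) where

  private
    p = 5 ℕ.^ N
    q = 9 ℕ.^ N

  -- Interchanging sizes and weights gives every fibre the sum p·q that `null` asks for.
  size weight : Fin 5 → ℕ
  size   zero    = p
  size   (suc _) = q
  weight zero    = q
  weight (suc _) = p

  balanced : ∀ k → Balanced (size k)
  balanced zero    = balanced-^ balanced₅ N
  balanced (suc _) = balanced-^ balanced₉ N

  open BlowUp (proj₁ balanced₅) size (proj₁ ∘ balanced) public using (graph; null)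

  φ : Vector ℤ (total size)
  φ i = + weight (proj₁ (decode size i))

  N<p : N < p
  N<p = n<m^n (from-yes (1 ℕ.<? 5)) N

  N<q : N < q
  N<q = n<m^n (from-yes (1 ℕ.<? 9)) N

  N<weight : ∀ k → N < weight k
  N<weight zero    = N<q
  N<weight (suc _) = N<p

  φ-null : Null (seidel graph) φ
  φ-null = null (λ k _ → + weight k) (+ (p ℕ.* q)) (proj₂ balanced₅) fibre-null fibre-sum
    where
    open ≡-Reasoning
    fibre-null : ∀ k → Null (seidel (proj₁ (balanced k))) (const (+ weight k))
    fibre-null k = Null-cong (λ _ → ℤ.*-identityʳ (+ weight k))
      (Null-scale (+ weight k) (proj₂ (balanced k)))
    size*weight : ∀ k → size k ℕ.* weight k ≡ p ℕ.* q
    size*weight zero    = refl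
    size*weight (suc _) = ℕ.*-comm q p
    fibre-sum : ∀ k → ℤΣ.sum {size k} (const (+ weight k)) ≡ + (p ℕ.* q)
    fibre-sum k = begin
      ℤΣ.sum {size k} (const (+ weight k))  ≡⟨ sum-const (size k) (+ weight k) ⟩
      + size k ℤ.* + weight k               ≡⟨ ℤ.pos-* (size k) (weight k) ⟨
      + (size k ℕ.* weight k)               ≡⟨ cong +_ (size*weight k) ⟩
      + (p ℕ.* q)                           ∎

  vertexIn : ∀ k → N < size k → Fin (total size)
  -- The bound N < `size k` also shows that fibre k is inhabited: position N is a vertex of it.
  vertexIn k N<size = encode size (k , Fin.fromℕ< N<size)

  ∣φ∣-vertexIn : ∀ k N<size → ∣ φ (vertexIn k N<size) ∣ ≡ weight k
  ∣φ∣-vertexIn k N<size = cong (weight ∘ proj₁) (decode-encode size (k , Fin.fromℕ< N<size))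

  φ-gcd≡1 : foldr gcd 0ℤ φ ≡ 1ℤ
  φ-gcd≡1 = foldr-gcd≡1 φ (vertexIn zero N<p) (vertexIn (suc zero) N<q)
    (subst₂ Coprime (sym (∣φ∣-vertexIn zero N<p)) (sym (∣φ∣-vertexIn (suc zero) N<q))
      (coprime-^ʳ (Coprime.sym (coprime-^ʳ (from-yes (Coprime.coprime? 5 9)) N)) N))

  N<∣φ∣ : ∀ i → N < ∣ φ i ∣
  N<∣φ∣ i = N<weight (proj₁ (decode size i))

  φ>0 : ∀ i → 0ℤ ℤ.< φ i
  φ>0 i = ℤ.+<+ (ℕ.≤-<-trans ℕ.z≤n (N<∣φ∣ i))

theorem4p3 : ∀ (N : ℕ) → Σ[ m ∈ ℕ ] Σ[ G ∈ Graph (suc m) ]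
    Singular (seidel G) ×
    (∃[ φ ] IsPhi (seidel G) φ ×
    (∀ ψ → IsPhi (seidel G) ψ → φ ≗ ψ) ×
    (∀ i → N < ∣ φ i ∣))
theorem4p3 N = fromNull graph φ φ-null φ-gcd≡1 φ>0 N<∣φ∣ (vertexIn zero N<p)
  where
  open Example N
  -- The order `total size` is not syntactically a successor. Generalising it to n permits matching
  -- on `suc m`, and the argument of type `Fin n` excludes n = 0.
  fromNull : (G : Graph n) (φ : Vector ℤ n) → Null (seidel G) φ → foldr gcd 0ℤ φ ≡ 1ℤ →
    (∀ i → 0ℤ ℤ.< φ i) → (∀ i → N < ∣ φ i ∣) → Fin n →
    Σ[ m ∈ ℕ ] Σ[ G ∈ Graph (suc m) ]
    Singular (seidel G) ×
    (∃[ φ ] IsPhi (seidel G) φ ×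
    (∀ ψ → IsPhi (seidel G) ψ → φ ≗ ψ) ×
    (∀ i → N < ∣ φ i ∣))
  fromNull {suc m} G φ φ-null gcd≡1 φ>0 N<∣φ∣ _ =
    m , G , Null⇒Singular φ-null (ℤ.<⇒≢ (φ>0 zero) ∘ sym) ,
    φ , φ-phi , (λ ψ ψ-phi → IsPhi-unique G φ-phi ψ-phi) , N<∣φ∣
    where
    φ-phi : IsPhi (seidel G) φ
    φ-phi = record
      { null                 = row φ-null
      ; gcd≡1                = gcd≡1
      ; firstNonzeroPositive = zero , φ>0 zero , λ _ ()
      }
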